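{- Let $F$ be a (finite, simple) forest with maximum degree $\Delta\ge 3$, and let $m\in\mathbb{N}$. Then the game colouring number of the $m$-th power $F^m$ satisfies \[\mathrm{col}_g(F^m)\le\frac{(\Delta-1)^m-1}{\Delta-2}+2^m+1.\]
   Context: All graphs are finite, simple and loopless. For a graph $G=(V,E)$ and $m\in\mathbb{N}$, the $m$-th power $G^m$ is the graph on vertex set $V$ in which two distinct vertices $v,w$ are adjacent if and only if $1\le \mathrm{dist}_G(v,w)\le m$, where $\mathrm{dist}_G$ is the usual shortest-path distance in $G$ (so $G^1=G$ and $G^0$ has no edges). The marking game on a graph $G=(V,E)$: two players, Alice and Bob, alternately mark previously unmarked vertices of $G$, Alice moving first, until every vertex is marked. This produces a linear ordering $\le$ of $V$ (the order in which vertices are marked). The back degree of $v$ is $bd_\le(v)=|\{w\in V: vw\in E,\ w\le v\}|$, and the score is $sc(G,\le)=1+\max_{v\in V} bd_\le(v)$. Alice tries to minimize the score and Bob tries to maximize it; the game colouring number $\mathrm{col}_g(G)$ is the score obtained when both players play optimally (equivalently, the smallest $s$ such that Alice has a strategy guaranteeing score at most $s$). -}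

module Defs where

open import Data.Nat using (ℕ; zero; suc; _≤_; _<_)
open import Data.Fin using (Fin)
open import Data.Fin.Properties using (_≟_)
open import Data.Bool using (Bool; true; false; _∧_; _∨_; not; T)
open import Data.List using (List; []; _∷_; length; filterᵇ; allFin; _∷ʳ_)
open import Data.Bool.ListAction using (any)
open import Data.List.Membership.Propositional using (_∈_; _∉_)
open import Data.List.Relation.Unary.Unique.Propositional using (Unique)
open import Data.Product using (Σ; _×_; ∃)
open import Data.Unit using (⊤)
open import Relation.Binary.PropositionalEquality using (_≡_)
open import Relation.Nullary using (¬_)
open import Relation.Nullary.Decidable using (⌊_⌋)

Adj : ℕ → Set
Adj n = Fin n → Fin n → Bool

IsSimpleGraph : ∀ {n} → Adj n → Set
IsSimpleGraph {n} G = (∀ (u v : Fin n) → G u v ≡ G v u) × (∀ (v : Fin n) → G v v ≡ false)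

deg : ∀ {n} → Adj n → Fin n → ℕ
deg {n} G v = length (filterᵇ (G v) (allFin n))

MaxDegree : ∀ {n} → Adj n → ℕ → Set
MaxDegree {n} G Δ = (∀ (v : Fin n) → deg G v ≤ Δ) × (∃ λ (v : Fin n) → deg G v ≡ Δ)

PathAdj : ∀ {n} → Adj n → List (Fin n) → Set
PathAdj G [] = ⊤
PathAdj G (x ∷ []) = ⊤
PathAdj G (x ∷ y ∷ r) = T (G x y) × PathAdj G (y ∷ r)

IsCycle : ∀ {n} → Adj n → Fin n → List (Fin n) → Set
IsCycle G x rest = (2 ≤ length rest) × Unique (x ∷ rest) × PathAdj G ((x ∷ rest) ∷ʳ x)

IsForest : ∀ {n} → Adj n → Set
IsForest {n} G = ¬ (Σ (Fin n) λ x → Σ (List (Fin n)) λ rest → IsCycle G x rest)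

reach : ∀ {n} → Adj n → ℕ → Fin n → Fin n → Bool
reach G zero u v = ⌊ u ≟ v ⌋
reach {n} G (suc k) u v = reach G k u v ∨ any (λ w → reach G k u w ∧ G w v) (allFin n)

power : ∀ {n} → Adj n → ℕ → Adj n
power G m u v = not ⌊ u ≟ v ⌋ ∧ reach G m u v

backDeg : ∀ {n} → Adj n → List (Fin n) → Fin n → ℕ
backDeg G M v = length (filterᵇ (G v) M)

-- Marking game with score bound s. M = list of already marked vertices.
-- A move marking v is "good" if backDeg M v < s, i.e. 1 + bd(v) ≤ s.
-- AliceWins G s M : it is Alice's turn in position M and Alice can force that
-- every remaining move is good (so the final score is ≤ s).
mutual
  data AliceWins {n} (G : Adj n) (s : ℕ) (M : List (Fin n)) : Set where
    finished : (∀ (v : Fin n) → v ∈ M) → AliceWins G s M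
    move     : (v : Fin n) → v ∉ M → backDeg G M v < s → BobTurn G s (v ∷ M) → AliceWins G s M

  data BobTurn {n} (G : Adj n) (s : ℕ) (M : List (Fin n)) : Set where
    respond : (∀ (v : Fin n) → v ∉ M → backDeg G M v < s × AliceWins G s (v ∷ M)) → BobTurn G s M

ColGameLe : ∀ {n} → Adj n → ℕ → Set
ColGameLe G s = AliceWins G s []

{-# OPTIONS --safe #-}
-- Successively removing leaves ranks the vertices so that each has at most one neighbour of higher
-- rank, its parent.  Every vertex that Bob marks releases a token that climbs towards the root.
-- A marked vertex lets it pass; an unmarked vertex lets its first token pass, and the second one
-- stops there and Alice marks that vertex.  If the token leaves the root, Alice releases another
-- one at any unmarked v and marks the vertex that stops it or, failing that, v itself.
--
-- So after Alice's move an unmarked v has received at most one token from its children.  If out c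
-- tokens have left c, then at most out c + 1 have entered it, whence by induction at most
-- out c * (2 ^ d - 1) vertices of its subtree at depth below d are marked.  Hence v has at most
-- 2 ^ m - 1 marked descendants within distance m, while at most
-- 1 + (Δ - 1) + ... + (Δ - 1) ^ (m - 1) vertices are reached through its parent.  One more
-- neighbour may be marked by Bob before Alice marks v.
module Submission where

open import Defs
open import Data.Bool using (Bool; true; false; _∧_; _∨_; not; T; if_then_else_)
open import Data.Bool.ListAction using (any)
open import Data.Bool.Properties using (T?; T-∧; T-∨)
open import Data.Empty using (⊥-elim)
open import Data.Fin using (Fin; zero; suc)
open import Data.Fin.Properties as Fin using (_≟_; injective⇒≤)
open import Data.List using (List; []; _∷_; length; map; filter; filterᵇ; lookup; allFin; _++_; _∷ʳ_)
open import Data.List.Membership.Propositional using (_∈_; _∉_; find; lose)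
open import Data.List.Membership.Propositional.Properties using (∈-∃++; ∈-allFin; ∈-filter⁺; ∈-lookup)
open import Data.List.Properties using (filter-notAll)
open import Data.List.Relation.Unary.All as All using (All; []; _∷_)
open import Data.List.Relation.Unary.All.Properties using (++⁻ˡ; ++⁻ʳ; ¬Any⇒All¬)
open import Data.List.Relation.Unary.AllPairs using ([]; _∷_)
open import Data.List.Relation.Unary.Any using (here; there; any?)
open import Data.List.Relation.Unary.Any.Properties using (any⁺; any⁻)
open import Data.List.Relation.Unary.Unique.Propositional using (Unique)
open import Data.List.Relation.Unary.Unique.Propositional.Properties using (allFin⁺)
open import Data.Nat hiding (_≟_)
open import Data.Nat.DivMod using (_/_; m*n/n≡m)
open import Data.Nat.ListAction using (sum)
open import Data.Nat.Properties hiding (_≟_)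
open import Data.Nat.Tactic.RingSolver using (solve-∀)
open import Data.Product using (_×_; _,_; proj₁; proj₂; ∃)
open import Data.Sum using (_⊎_; inj₁; inj₂)
open import Data.Unit using (tt)
open import Function using (_∘_; Equivalence)
open import Relation.Binary.Definitions using (tri<; tri≈; tri>)
open import Relation.Binary.PropositionalEquality using (_≡_; _≢_; refl; sym; trans; cong; cong₂; subst)
open import Relation.Nullary using (¬_; yes; no; contradiction; ¬?; _×-dec_)
open import Relation.Nullary.Decidable using (decidable-stable; ⌊_⌋; toWitness; fromWitness; toWitnessFalse; fromWitnessFalse)

-- Counting and summing over lists.

# : {A : Set} → (A → Bool) → List A → ℕ
# p L = length (filterᵇ p L)

∑ : {A : Set} → List A → (A → ℕ) → ℕ
∑ L f = sum (map f L)

infixl 6 _when_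
_when_ : ℕ → Bool → ℕ
k when b = if b then k else 0

when-mono : ∀ {b c j k} → (T b → T c) → (T b → j ≤ k) → j when b ≤ k when c
when-mono {false}        _ _ = z≤n
when-mono {true} {true}  _ h = h _
when-mono {true} {false} f _ = ⊥-elim (f _)

module _ {A : Set} where

  #-mono : {p q : A → Bool} → (∀ x → T (p x) → T (q x)) → ∀ L → # p L ≤ # q L
  #-mono imp [] = z≤n
  #-mono {p} {q} imp (x ∷ L) with p x | q x | imp x
  ... | false | false | _ = #-mono imp L
  ... | false | true  | _ = m≤n⇒m≤1+n (#-mono imp L)
  ... | true  | true  | _ = s≤s (#-mono imp L)
  ... | true  | false | i = ⊥-elim (i _)

  #-∨ : (p q : A → Bool) → ∀ L → # (λ x → p x ∨ q x) L ≤ # p L + # q L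
  #-∨ p q [] = z≤n
  #-∨ p q (x ∷ L) with p x | q x
  ... | false | false = #-∨ p q L
  ... | false | true  = ≤-trans (s≤s (#-∨ p q L)) (≤-reflexive (sym (+-suc (# p L) (# q L))))
  ... | true  | false = s≤s (#-∨ p q L)
  ... | true  | true  = s≤s (≤-trans (#-∨ p q L) (+-monoʳ-≤ (# p L) (n≤1+n _)))

  #-false : ∀ (L : List A) → # (λ _ → false) L ≡ 0
  #-false [] = refl
  #-false (x ∷ L) = #-false L

  #-when : ∀ b (q : A → Bool) L → # (λ u → b ∧ q u) L ≡ # q L when b
  #-when false q L = #-false L
  #-when true  q L = refl

  #-any : {B : Set} (q : B → A → Bool) (K : List B) (L : List A)
        → # (λ u → any (λ z → q z u) K) L ≤ ∑ K (λ z → # (q z) L)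
  #-any q []      L = ≤-reflexive (#-false L)
  #-any q (z ∷ K) L = ≤-trans (#-∨ (q z) (λ u → any (λ z → q z u) K) L) (+-monoʳ-≤ (# (q z) L) (#-any q K L))

  #-none : {p : A → Bool} → ∀ {L} → All (λ x → ¬ T (p x)) L → # p L ≡ 0
  #-none [] = refl
  #-none {p} {x ∷ L} (n ∷ ns) with p x
  ... | true  = ⊥-elim (n _)
  ... | false = #-none ns

  #-subsingleton : {p : A → Bool} → (∀ {x y} → T (p x) → T (p y) → x ≡ y)
                 → ∀ {L} → Unique L → # p L ≤ 1
  #-subsingleton h [] = z≤n
  #-subsingleton {p} h {x ∷ L} (x∉ ∷ u) with p x in eq
  ... | false = #-subsingleton h u
  ... | true  = s≤s (≤-reflexive (#-none (All.map (λ x≢y py → x≢y (h (subst T (sym eq) _) py)) x∉)))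

  #-drop : {p q : A → Bool} → (∀ x → T (q x) → T (p x)) → ∀ {y L} → y ∈ L → T (p y) → ¬ T (q y)
         → suc (# q L) ≤ # p L
  #-drop {p} {q} imp {y} {L = x ∷ L} (here refl) py nqy with p x | q x
  ... | true  | false = s≤s (#-mono imp L)
  ... | true  | true  = ⊥-elim (nqy _)
  #-drop {p} {q} imp {L = x ∷ L} (there y∈) py nqy with p x | q x | imp x
  ... | false | false | _ = #-drop imp y∈ py nqy
  ... | true  | false | _ = m≤n⇒m≤1+n (#-drop imp y∈ py nqy)
  ... | true  | true  | _ = s≤s (#-drop imp y∈ py nqy)
  ... | false | true  | i = ⊥-elim (i _)

  #-cons : (p : A → Bool) → ∀ x L → # p (x ∷ L) ≤ suc (# p L)
  #-cons p x L with p x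
  ... | true  = ≤-refl
  ... | false = n≤1+n _

  ∑-mono : {f g : A → ℕ} → (∀ x → f x ≤ g x) → ∀ L → ∑ L f ≤ ∑ L g
  ∑-mono h []      = z≤n
  ∑-mono h (x ∷ L) = +-mono-≤ (h x) (∑-mono h L)

  ∑-+ : ∀ (f g : A → ℕ) L → ∑ L (λ x → f x + g x) ≡ ∑ L f + ∑ L g
  ∑-+ f g []      = refl
  ∑-+ f g (x ∷ L) rewrite ∑-+ f g L = lemma (f x) (g x) (∑ L f) (∑ L g)
    where
    lemma : ∀ a b c d → a + b + (c + d) ≡ a + c + (b + d)
    lemma = solve-∀

  ∑-const : ∀ (p : A → Bool) k L → ∑ L (λ x → k when p x) ≡ # p L * k
  ∑-const p k [] = refl
  ∑-const p k (x ∷ L) with p x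
  ... | true  = cong (k +_) (∑-const p k L)
  ... | false = ∑-const p k L

  ∑-*ʳ : ∀ (p : A → Bool) (f : A → ℕ) k L → ∑ L (λ x → f x * k when p x) ≡ ∑ L (λ x → f x when p x) * k
  ∑-*ʳ p f k [] = refl
  ∑-*ʳ p f k (x ∷ L) with p x
  ... | true  = trans (cong (f x * k +_) (∑-*ʳ p f k L)) (sym (*-distribʳ-+ k (f x) _))
  ... | false = ∑-*ʳ p f k L

  -- Only one entry can exceed its counterpart, so one new token adds at most one to an inflow.
  ∑-bump : ∀ {f g : A → ℕ} {e : A → Bool} → (∀ {x y} → T (e x) → T (e y) → x ≡ y)
         → (∀ z → f z ≤ g z + (1 when e z)) → ∀ {L} → Unique L → ∑ L f ≤ suc (∑ L g)
  ∑-bump {f} {g} {e} e-sub h {L} uL = begin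
    ∑ L f                             ≤⟨ ∑-mono h L ⟩
    ∑ L (λ z → g z + (1 when e z))    ≡⟨ ∑-+ g (λ z → 1 when e z) L ⟩
    ∑ L g + ∑ L (λ z → 1 when e z)    ≡⟨ cong (∑ L g +_) (∑-const e 1 L) ⟩
    ∑ L g + # e L * 1                 ≤⟨ +-monoʳ-≤ (∑ L g) (*-monoˡ-≤ 1 (#-subsingleton e-sub uL)) ⟩
    ∑ L g + 1                         ≡⟨ +-comm (∑ L g) 1 ⟩
    suc (∑ L g)                       ∎
    where open ≤-Reasoning

-- Lists without repetition, and paths.

module _ {A : Set} where

  lookup-injective : {L : List A} → Unique L → ∀ {i j} → lookup L i ≡ lookup L j → i ≡ j
  lookup-injective (_ ∷ _)  {zero}  {zero}  _  = refl
  lookup-injective (x∉ ∷ _) {zero}  {suc j} eq = ⊥-elim (All.lookupWith (λ x≢y y≡ → x≢y (trans eq y≡)) x∉ (∈-lookup j))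
  lookup-injective u@(_ ∷ _) {suc i} {zero}  eq = sym (lookup-injective u (sym eq))
  lookup-injective (_ ∷ u)  {suc i} {suc j} eq = cong suc (lookup-injective u eq)

  -- `z` comes first because a cycle closed by an edge back to `z` is listed from `z` on.
  Unique-prefix : ∀ as {z : A} {post} → Unique (as ++ z ∷ post) → Unique (z ∷ as)
  Unique-prefix []       (_ ∷ _)  = [] ∷ []
  Unique-prefix (a ∷ as) (a∉ ∷ u) with Unique-prefix as u
  ... | z∉ ∷ u′ = ((All.head (++⁻ʳ as a∉) ∘ sym) ∷ z∉) ∷ ++⁻ˡ as a∉ ∷ u′

Unique⇒length≤ : ∀ {n} {L : List (Fin n)} → Unique L → length L ≤ n
Unique⇒length≤ u = injective⇒≤ (lookup-injective u)

PathAdj-prefix : ∀ {n} (G : Adj n) as {z post} → PathAdj G (as ++ z ∷ post) → PathAdj G (as ∷ʳ z)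
PathAdj-prefix G []           _       = tt
PathAdj-prefix G (a ∷ [])     (e , _) = e , tt
PathAdj-prefix G (a ∷ b ∷ as) (e , p) = e , PathAdj-prefix G (b ∷ as) p

-- Rooting a forest by removing leaves.

-- The neighbour of higher rank is the parent. Injectivity gives every edge a direction, `height`
-- bounds every climb, and restricting to `S` permits induction on leaf removal.
record RootedOn {n} (G : Adj n) (S : List (Fin n)) : Set where
  field
    rank           : Fin n → ℕ
    height         : ℕ
    rank≤height    : ∀ v → rank v ≤ height
    rank-injective : ∀ {v x} → v ∈ S → x ∈ S → rank v ≡ rank x → v ≡ x
    parent-unique  : ∀ {v x y} → v ∈ S → x ∈ S → y ∈ S → T (G v x) → T (G v y)
                   → rank v < rank x → rank v < rank y → x ≡ y

module _ {n} (G : Adj n) (simple : IsSimpleGraph G) where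

  adj-sym : ∀ {u v} → T (G u v) → T (G v u)
  adj-sym {u} {v} = subst T (proj₁ simple u v)

  adj-irrefl : ∀ {v} → ¬ T (G v v)
  adj-irrefl {v} = subst T (proj₂ simple v)

  module _ (forest : IsForest G) where

    open import Data.List.Membership.DecPropositional (_≟_ {n}) using (_∈?_)

    -- An isolated vertex counts as a leaf, so the last vertex of a tree can be removed as well.
    IsLeafIn : List (Fin n) → Fin n → Set
    IsLeafIn S x = ∀ {y z} → y ∈ S → z ∈ S → T (G x y) → T (G x z) → y ≡ z

    -- A path that never gets stuck at a leaf either closes up to a cycle or outgrows the vertex set.
    leaf-beyond-path : ∀ S k {x y rest} → x ∈ S → Unique (x ∷ y ∷ rest) → PathAdj G (x ∷ y ∷ rest)
                     → n < k + length (x ∷ y ∷ rest) → ∃ λ l → l ∈ S × IsLeafIn S l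
    leaf-beyond-path S zero x∈ u p n< = contradiction (Unique⇒length≤ u) (<⇒≱ n<)
    leaf-beyond-path S (suc k) {x} {y} {rest} x∈ u p n<
      with any? (λ z → T? (G x z) ×-dec ¬? (z ≟ y)) S
    ... | no none = x , x∈ , λ a∈ b∈ xa xb → trans (only-y a∈ xa) (sym (only-y b∈ xb))
      where
      only-y : ∀ {z} → z ∈ S → T (G x z) → z ≡ y
      only-y {z} z∈ xz = decidable-stable (z ≟ y) λ z≢y → none (lose z∈ (xz , z≢y))
    ... | yes some with find some
    ... | z , z∈ , xz , z≢y with z ∈? rest
    ... | yes z∈rest with ∈-∃++ z∈rest
    ... | pre , post , refl =
      -- The cycle runs from `z` to `x`, along the path through `y` and `pre`, and back to `z`; `x`
      -- and `y` are the two further vertices it needs.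
      ⊥-elim (forest (z , x ∷ y ∷ pre , s≤s (s≤s z≤n) , Unique-prefix (x ∷ y ∷ pre) u ,
                      adj-sym xz , PathAdj-prefix G (x ∷ y ∷ pre) p))
    leaf-beyond-path S (suc k) {x} {y} {rest} x∈ u p n< | yes _ | z , z∈ , xz , z≢y | no z∉rest =
      leaf-beyond-path S k z∈ ((z≢x ∷ z≢y ∷ ¬Any⇒All¬ rest z∉rest) ∷ u) (adj-sym xz , p)
        (subst (n <_) (sym (+-suc k _)) n<)
      where
      z≢x : z ≢ x
      z≢x refl = adj-irrefl xz

    leaf-exists : ∀ {x} S → x ∈ S → ∃ λ l → l ∈ S × IsLeafIn S l
    leaf-exists {x} S x∈ with any? (λ y → T? (G x y)) S
    ... | no none = x , x∈ , λ a∈ _ xa _ → contradiction (lose a∈ xa) none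
    ... | yes some with find some
    -- Fuel `n` suffices: the path has two vertices already and can never have more than `n`.
    ... | y , y∈ , xy = leaf-beyond-path S n y∈ ((y≢x ∷ []) ∷ [] ∷ []) (adj-sym xy , tt)
                          (subst (n <_) (+-comm 2 n) (n≤1+n _))
      where
      y≢x : y ≢ x
      y≢x refl = adj-irrefl xy

    -- The removed leaf gets rank 0 and all others move up by one: the leaf lies below its only
    -- neighbour in `S`, if any, and is nobody's parent.
    root : ∀ k S → length S ≤ k → RootedOn G S
    root k [] _ = record
      { rank = λ _ → 0 ; height = 0 ; rank≤height = λ _ → z≤n
      ; rank-injective = λ () ; parent-unique = λ () }
    root (suc k) S@(_ ∷ _) S≤ with leaf-exists S (here refl)
    ... | l , l∈ , leaf = record
      { rank = rank′ ; height = suc height ; rank≤height = rank′≤ ; rank-injective = inj ; parent-unique = uniq }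
      where
      ≢l? = λ x → ¬? (x ≟ l)
      open RootedOn (root k (filter ≢l? S)
        (s≤s⁻¹ (≤-trans (filter-notAll ≢l? S (lose l∈ (λ ne → ne refl))) S≤)))
      rank′ : Fin n → ℕ
      rank′ x with x ≟ l
      ... | yes _ = 0
      ... | no  _ = suc (rank x)
      rank′≤ : ∀ v → rank′ v ≤ suc height
      rank′≤ v with v ≟ l
      ... | yes _ = z≤n
      ... | no  _ = s≤s (rank≤height v)
      inj : ∀ {v x} → v ∈ S → x ∈ S → rank′ v ≡ rank′ x → v ≡ x
      inj {v} {x} v∈ x∈ eq with v ≟ l | x ≟ l
      ... | yes refl | yes refl = refl
      ... | no v≢    | no x≢    =
        rank-injective (∈-filter⁺ ≢l? v∈ v≢) (∈-filter⁺ ≢l? x∈ x≢) (suc-injective eq)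
      uniq : ∀ {v x y} → v ∈ S → x ∈ S → y ∈ S → T (G v x) → T (G v y)
           → rank′ v < rank′ x → rank′ v < rank′ y → x ≡ y
      uniq {v} {x} {y} v∈ x∈ y∈ vx vy v<x v<y with v ≟ l | x ≟ l | y ≟ l
      ... | yes refl | _     | _     = leaf x∈ y∈ vx vy
      ... | no v≢    | no x≢ | no y≢ =
        parent-unique (∈-filter⁺ ≢l? v∈ v≢) (∈-filter⁺ ≢l? x∈ x≢) (∈-filter⁺ ≢l? y∈ y≢)
          vx vy (s<s⁻¹ v<x) (s<s⁻¹ v<y)

-- Boolean tests, walks, and balls in the power graph.

∧⁻ : ∀ {b c} → T (b ∧ c) → T b × T c
∧⁻ = Equivalence.to T-∧

∧⁺ : ∀ {b c} → T b → T c → T (b ∧ c)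
∧⁺ p q = Equivalence.from T-∧ (p , q)

∨⁻ : ∀ {b c} → T (b ∨ c) → T b ⊎ T c
∨⁻ = Equivalence.to T-∨

≢ᵇ⁻ : ∀ {n} {x y : Fin n} → T (not ⌊ x ≟ y ⌋) → x ≢ y
≢ᵇ⁻ {x = x} {y} = toWitnessFalse {a? = x ≟ y}

≢ᵇ⁺ : ∀ {n} {x y : Fin n} → x ≢ y → T (not ⌊ x ≟ y ⌋)
≢ᵇ⁺ {x = x} {y} = fromWitnessFalse {a? = x ≟ y}

-- The vertices reached from x by a walk of fewer than d steps that never reverses an edge,
-- having entered x from y.
ball : ∀ {n} → Adj n → ℕ → Fin n → Fin n → Fin n → Bool
ball     G zero    x y u = false
ball {n} G (suc d) x y u =
  ⌊ x ≟ u ⌋ ∨ any (λ z → (G x z ∧ not ⌊ z ≟ y ⌋) ∧ ball G d z x u) (allFin n)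

module _ {n} (G : Adj n) where

  -- The index only bounds the number of steps, as in `reach`: `stay` exists at every index.
  data Walk : ℕ → Fin n → Fin n → Set where
    stay : ∀ {k v} → Walk k v v
    step : ∀ {k v w u} → T (G v w) → Walk k w u → Walk (suc k) v u

  Walk-snoc : ∀ {k v w u} → Walk k v w → T (G w u) → Walk (suc k) v u
  Walk-snoc stay       e = step e stay
  Walk-snoc (step a p) e = step a (Walk-snoc p e)

  Walk-weaken : ∀ {k v w} → Walk k v w → Walk (suc k) v w
  Walk-weaken stay       = stay
  Walk-weaken (step a p) = step a (Walk-weaken p)

  reach⇒Walk : ∀ k {v u} → T (reach G k v u) → Walk k v u
  reach⇒Walk zero r with refl ← toWitness r = stay
  reach⇒Walk (suc k) {v} {u} r with ∨⁻ {reach G k v u} r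
  ... | inj₁ r′ = Walk-weaken (reach⇒Walk k r′)
  ... | inj₂ s with find (any⁻ _ (allFin n) s)
  ... | w , _ , rw with ∧⁻ {reach G k v w} rw
  ... | r′ , e = Walk-snoc (reach⇒Walk k r′) e

  ball-centre : ∀ d {x y} → T (ball G (suc d) x y x)
  ball-centre d {x} = Equivalence.from T-∨ (inj₁ (fromWitness {a? = x ≟ x} refl))

  ball-step : ∀ d {x y z u} → T (G x z) → z ≢ y → T (ball G d z x u) → T (ball G (suc d) x y u)
  ball-step d {x} {y} {z} xz z≢y b =
    Equivalence.from T-∨ (inj₂ (any⁺ _ (lose (∈-allFin z) (∧⁺ (∧⁺ xz (≢ᵇ⁺ z≢y)) b))))

  ball-inv : ∀ d {x y u} → T (ball G (suc d) x y u)
           → x ≡ u ⊎ ∃ λ z → T (G x z) × z ≢ y × T (ball G d z x u)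
  ball-inv d {x} {y} {u} b with ∨⁻ {⌊ x ≟ u ⌋} b
  ... | inj₁ eq = inj₁ (toWitness eq)
  ... | inj₂ s with find (any⁻ _ (allFin n) s)
  ... | z , _ , h with ∧⁻ {G x z ∧ _} h
  ... | g , b′ with ∧⁻ {G x z} g
  ... | xz , z≢ = inj₂ (z , xz , ≢ᵇ⁻ z≢ , b′)

  ball-weaken : ∀ d {x y u} → T (ball G d x y u) → T (ball G (suc d) x y u)
  ball-weaken (suc d) b with ball-inv d b
  ... | inj₁ refl               = ball-centre (suc d)
  ... | inj₂ (z , xz , z≢ , b′) = ball-step (suc d) xz z≢ (ball-weaken d b′)

  -- Reversals cancel: if the reduced walk from `w` starts by returning to `v`, both steps are
  -- dropped and what follows is a shorter reduced walk from `v`.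
  Walk⇒ball : ∀ {k v u} → Walk k v u → v ≡ u ⊎ ∃ λ x → T (G v x) × T (ball G k x v u)
  Walk⇒ball stay = inj₁ refl
  Walk⇒ball (step {suc k} vw p) with Walk⇒ball p
  Walk⇒ball (step {suc k} {w = w} vw p) | inj₁ refl = inj₂ (w , vw , ball-centre (suc k))
  Walk⇒ball (step {suc k} {v} {w} vw p) | inj₂ (x , wx , b) with x ≟ v
  ... | no x≢v = inj₂ (w , vw , ball-step (suc k) wx x≢v b)
  ... | yes refl with ball-inv k b
  ... | inj₁ refl              = inj₁ refl
  ... | inj₂ (z , vz , _ , b′) = inj₂ (z , vz , ball-weaken (suc k) (ball-weaken k b′))
  Walk⇒ball (step {zero} {w = w} vw stay) = inj₂ (w , vw , ball-centre zero)

  power⇒ball : ∀ m {v u} → T (power G m v u) → T (any (λ x → G v x ∧ ball G m x v u) (allFin n))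
  power⇒ball m {v} {u} p with ∧⁻ {not ⌊ v ≟ u ⌋} p
  ... | v≢u , r with Walk⇒ball (reach⇒Walk m r)
  ... | inj₁ v≡u          = contradiction v≡u (≢ᵇ⁻ v≢u)
  ... | inj₂ (x , vx , b) = any⁺ _ (lose (∈-allFin x) (∧⁺ vx b))

  -- Union bound over the first step of a walk to a marked vertex.
  backDeg-power≤ : ∀ m M v
    → backDeg (power G m) M v ≤ ∑ (allFin n) (λ x → # (ball G m x v) M when G v x)
  backDeg-power≤ m M v = begin
    # (power G m v) M
      ≤⟨ #-mono (λ _ → power⇒ball m) M ⟩
    # (λ u → any (λ x → G v x ∧ ball G m x v u) (allFin n)) M
      ≤⟨ #-any (λ x u → G v x ∧ ball G m x v u) (allFin n) M ⟩
    ∑ (allFin n) (λ x → # (λ u → G v x ∧ ball G m x v u) M)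
      ≤⟨ ∑-mono (λ x → ≤-reflexive (#-when (G v x) (ball G m x v) M)) (allFin n) ⟩
    ∑ (allFin n) (λ x → # (ball G m x v) M when G v x)
      ∎
    where open ≤-Reasoning

  #-ball-suc : ∀ d x y M → # (ball G (suc d) x y) M
    ≤ # (λ u → ⌊ x ≟ u ⌋) M + ∑ (allFin n) (λ z → # (ball G d z x) M when (G x z ∧ not ⌊ z ≟ y ⌋))
  #-ball-suc d x y M = begin
    # (ball G (suc d) x y) M
      ≤⟨ #-∨ (λ u → ⌊ x ≟ u ⌋) _ M ⟩
    # (λ u → ⌊ x ≟ u ⌋) M + # (λ u → any (λ z → q z ∧ ball G d z x u) (allFin n)) M
      ≤⟨ +-monoʳ-≤ _ (#-any (λ z u → q z ∧ ball G d z x u) (allFin n) M) ⟩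
    # (λ u → ⌊ x ≟ u ⌋) M + ∑ (allFin n) (λ z → # (λ u → q z ∧ ball G d z x u) M)
      ≤⟨ +-monoʳ-≤ _ (∑-mono (λ z → ≤-reflexive (#-when (q z) (ball G d z x) M)) (allFin n)) ⟩
    # (λ u → ⌊ x ≟ u ⌋) M + ∑ (allFin n) (λ z → # (ball G d z x) M when q z)
      ∎
    where
    open ≤-Reasoning
    q = λ z → G x z ∧ not ⌊ z ≟ y ⌋

-- Geometric sums and the degree bound for balls.

-- The sum `1 + a + ... + a ^ (d - 1)` in Horner form. It is `2 ^ d - 1` for `a = 2` and the
-- fraction of the theorem when `a` is the maximum degree minus one.
geometric : ℕ → ℕ → ℕ
geometric a zero    = 0
geometric a (suc d) = 1 + a * geometric a d

geometric-closed : ∀ a d → geometric (suc (suc a)) d ≡ (suc (suc a) ^ d ∸ 1) / suc a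
geometric-closed a d = sym (trans (cong (λ p → (p ∸ 1) / suc a) (sym (main d))) (m*n/n≡m (geometric (2 + a) d) (suc a)))
  where
  main : ∀ d → suc (geometric (2 + a) d * suc a) ≡ (2 + a) ^ d
  main zero    = refl
  main (suc d) = trans (expand a (geometric (2 + a) d)) (cong ((2 + a) *_) (main d))
    where
    expand : ∀ a g → suc ((1 + (2 + a) * g) * suc a) ≡ (2 + a) * suc (g * suc a)
    expand = solve-∀

geometric-2 : ∀ d → suc (geometric 2 d) ≡ 2 ^ d
geometric-2 zero    = refl
geometric-2 (suc d) = trans (expand (geometric 2 d)) (cong (2 *_) (geometric-2 d))
  where
  expand : ∀ g → suc (1 + 2 * g) ≡ 2 * suc g
  expand = solve-∀

≟-subsingleton : ∀ {n} {c : Fin n} {x y : Fin n} → T ⌊ c ≟ x ⌋ → T ⌊ c ≟ y ⌋ → x ≡ y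
≟-subsingleton {c = c} {x} {y} p q = trans (sym (toWitness {a? = c ≟ x} p)) (toWitness {a? = c ≟ y} q)

-- Here `Δ` is one less than the degree bound: the edge to `y` is spent, so at most `Δ` neighbours
-- of `x` remain for the next step.
#-ball≤ : ∀ {n} (G : Adj n) (Δ : ℕ) → (∀ u v → G u v ≡ G v u) → (∀ v → deg G v ≤ suc Δ)
        → ∀ {M} → Unique M → ∀ d {x y} → T (G x y) → # (ball G d x y) M ≤ geometric Δ d
#-ball≤ {n} G Δ sm deg≤ {M} uM zero    xy = ≤-reflexive (#-false M)
#-ball≤ {n} G Δ sm deg≤ {M} uM (suc d) {x} {y} xy = begin
  # (ball G (suc d) x y) M
    ≤⟨ #-ball-suc G d x y M ⟩
  # (λ u → ⌊ x ≟ u ⌋) M + ∑ (allFin n) (λ z → # (ball G d z x) M when q z)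
    ≤⟨ +-mono-≤ (#-subsingleton ≟-subsingleton uM) (∑-mono (λ z → when-mono {b = q z} (λ t → t) (bound z)) (allFin n)) ⟩
  1 + ∑ (allFin n) (λ z → geometric Δ d when q z)
    ≡⟨ cong (1 +_) (∑-const q (geometric Δ d) (allFin n)) ⟩
  1 + # q (allFin n) * geometric Δ d
    ≤⟨ +-monoʳ-≤ 1 (*-monoˡ-≤ (geometric Δ d) (s≤s⁻¹ (≤-trans other-neighbours (deg≤ x)))) ⟩
  1 + Δ * geometric Δ d
    ∎
  where
  open ≤-Reasoning
  q = λ z → G x z ∧ not ⌊ z ≟ y ⌋
  other-neighbours : suc (# q (allFin n)) ≤ deg G x
  other-neighbours = #-drop (λ z → proj₁ ∘ ∧⁻ {G x z}) (∈-allFin y) xy (λ t → ≢ᵇ⁻ {x = y} {y} (proj₂ (∧⁻ {G x y} t)) refl)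
  bound : ∀ z → T (q z) → # (ball G d z x) M ≤ geometric Δ d
  bound z t = #-ball≤ G Δ sm deg≤ uM d (subst T (sm x z) (proj₁ (∧⁻ {G x z} t)))

-- Parents, children and the balance of tokens.

module Rooted {n} (G : Adj n) (simple : IsSimpleGraph G) (rooted : RootedOn G (allFin n)) where
  open RootedOn rooted
  open import Data.List.Membership.DecPropositional (_≟_ {n}) using (_∈?_)

  V : List (Fin n)
  V = allFin n

  -- `up v x` makes `x` the parent of `v`, `down v x` a child of `v`.
  up down : Fin n → Fin n → Bool
  up   v x = G v x ∧ (rank v <ᵇ rank x)
  down v x = G v x ∧ (rank x <ᵇ rank v)

  up⁻ : ∀ {v x} → T (up v x) → T (G v x) × rank v < rank x
  up⁻ {v} {x} t with ∧⁻ {G v x} t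
  ... | vx , lt = vx , <ᵇ⇒< _ _ lt

  down⁻ : ∀ {v x} → T (down v x) → T (G v x) × rank x < rank v
  down⁻ {v} {x} t with ∧⁻ {G v x} t
  ... | vx , lt = vx , <ᵇ⇒< _ _ lt

  down⇒up : ∀ {v x} → T (down v x) → T (up x v)
  down⇒up {v} {x} t with down⁻ t
  ... | vx , lt = ∧⁺ (adj-sym G simple vx) (<⇒<ᵇ lt)

  up-or-down : ∀ {v x} → T (G v x) → T (up v x) ⊎ T (down v x)
  up-or-down {v} {x} vx with <-cmp (rank v) (rank x)
  ... | tri< lt _ _ = inj₁ (∧⁺ vx (<⇒<ᵇ lt))
  ... | tri> _ _ gt = inj₂ (∧⁺ vx (<⇒<ᵇ gt))
  ... | tri≈ _ eq _ with rank-injective (∈-allFin v) (∈-allFin x) eq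
  ... | refl = ⊥-elim (adj-irrefl G simple vx)

  up-unique : ∀ {v x y} → T (up v x) → T (up v y) → x ≡ y
  up-unique {v} {x} {y} p q with up⁻ {v} {x} p | up⁻ {v} {y} q
  ... | vx , v<x | vy , v<y = parent-unique (∈-allFin v) (∈-allFin x) (∈-allFin y) vx vy v<x v<y

  inflow : (Fin n → ℕ) → Fin n → ℕ
  inflow out c = ∑ V (λ z → out z when down c z)

  -- Here o is the number of tokens that have left c and i the number that have entered it from
  -- its children.
  BalancedAt : List (Fin n) → Fin n → ℕ → ℕ → Set
  BalancedAt M c o i = (c ∉ M → i ≤ o × o ≤ 1) × (c ∈ M → 1 ≤ o × i ≤ suc o)

  -- The slack in `i ≤ suc o` at a marked vertex is the token that stopped there. At an unmarked
  -- vertex `i < o` can occur: Alice may have released a token there that stopped higher up.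
  Balanced : List (Fin n) → (Fin n → ℕ) → Fin n → Set
  Balanced M out c = BalancedAt M c (out c) (inflow out c)

  module _ {M : List (Fin n)} (uM : Unique M) {out : Fin n → ℕ} (bal : ∀ c → Balanced M out c) where

    -- The base 2 comes from marked vertices: there `out c ≥ 1`, so the inflow is at most
    -- `1 + out c ≤ 2 * out c`, and `out c` also pays for `c` itself.
    #-subtree≤ : ∀ d {c v} → T (down v c) → # (ball G d c v) M ≤ out c * geometric 2 d
    #-subtree≤ zero    {c} _ = ≤-trans (≤-reflexive (#-false M)) z≤n
    #-subtree≤ (suc d) {c} {v} vc = begin
      # (ball G (suc d) c v) M
        ≤⟨ #-ball-suc G d c v M ⟩
      # here? M + ∑ V (λ z → # (ball G d z c) M when (G c z ∧ not ⌊ z ≟ v ⌋))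
        ≤⟨ +-monoʳ-≤ (# here? M) (∑-mono (λ z → when-mono (child z) (λ t → #-subtree≤ d (child z t))) V) ⟩
      # here? M + ∑ V (λ z → out z * e when down c z)
        ≡⟨ cong (# here? M +_) (∑-*ʳ (down c) out e V) ⟩
      # here? M + inflow out c * e
        ≤⟨ split ⟩
      out c * (1 + 2 * e)
        ∎
      where
      open ≤-Reasoning
      e = geometric 2 d
      here? = λ u → ⌊ c ≟ u ⌋
      child : ∀ z → T (G c z ∧ not ⌊ z ≟ v ⌋) → T (down c z)
      child z t with ∧⁻ {G c z} t
      ... | cz , z≢v with up-or-down cz
      ... | inj₂ below = below
      -- The only way up from `c` leads to `v`, and the walk may not reverse.
      ... | inj₁ above = contradiction (up-unique above (down⇒up vc)) (≢ᵇ⁻ z≢v)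
      split : # here? M + inflow out c * e ≤ out c * (1 + 2 * e)
      split with c ∈? M
      ... | no c∉ = begin
        # here? M + inflow out c * e
          ≡⟨ cong (_+ inflow out c * e) (#-none (All.map (λ c≢ → c≢ ∘ toWitness) (¬Any⇒All¬ M c∉))) ⟩
        inflow out c * e
          ≤⟨ *-mono-≤ (proj₁ (proj₁ (bal c) c∉)) (≤-trans (m≤n*m e 2) (n≤1+n _)) ⟩
        out c * (1 + 2 * e)
          ∎
      ... | yes c∈ = begin
        # here? M + inflow out c * e
          ≤⟨ +-mono-≤ (#-subsingleton ≟-subsingleton uM) (*-monoˡ-≤ e (proj₂ (proj₂ (bal c) c∈))) ⟩
        1 + (1 + out c) * e
          ≤⟨ absorb (proj₁ (proj₂ (bal c) c∈)) ⟩
        out c * (1 + 2 * e)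
          ∎
        where
        absorb : ∀ {o} → 1 ≤ o → 1 + (1 + o) * e ≤ o * (1 + 2 * e)
        absorb {suc o} _ = ≤-trans (m≤m+n _ (o + o * e)) (≤-reflexive (expand o e))
          where
          expand : ∀ o e → 1 + (2 + o) * e + (o + o * e) ≡ (1 + o) * (1 + 2 * e)
          expand = solve-∀

    -- The side of the parent is bounded by degrees alone. The children of the unmarked `v` have
    -- sent it at most one token in total, so their subtrees share a single `geometric 2 m`.
    backDeg≤ : ∀ {a} → (∀ v → deg G v ≤ suc a) → ∀ m {v} → v ∉ M
             → backDeg (power G m) M v ≤ geometric a m + geometric 2 m
    backDeg≤ {a} deg≤ m {v} v∉ = begin
      backDeg (power G m) M v
        ≤⟨ backDeg-power≤ G m M v ⟩
      ∑ V (λ x → # (ball G m x v) M when G v x)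
        ≤⟨ ∑-mono split V ⟩
      ∑ V (λ x → (geometric a m when up v x) + (out x * geometric 2 m when down v x))
        ≡⟨ ∑-+ (λ x → geometric a m when up v x) _ V ⟩
      ∑ V (λ x → geometric a m when up v x) + ∑ V (λ x → out x * geometric 2 m when down v x)
        ≡⟨ cong₂ _+_ (∑-const (up v) _ V) (∑-*ʳ (down v) out _ V) ⟩
      # (up v) V * geometric a m + inflow out v * geometric 2 m
        ≤⟨ +-mono-≤ (*-monoˡ-≤ (geometric a m) (#-subsingleton up-unique (allFin⁺ n)))
                    (*-monoˡ-≤ (geometric 2 m) (≤-trans (proj₁ (proj₁ (bal v) v∉)) (proj₂ (proj₁ (bal v) v∉)))) ⟩
      1 * geometric a m + 1 * geometric 2 m
        ≡⟨ cong₂ _+_ (*-identityˡ (geometric a m)) (*-identityˡ (geometric 2 m)) ⟩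
      geometric a m + geometric 2 m
        ∎
      where
      open ≤-Reasoning
      split : ∀ x → # (ball G m x v) M when G v x
                  ≤ (geometric a m when up v x) + (out x * geometric 2 m when down v x)
      split x with T? (G v x)
      ... | no ¬vx = ≤-trans (when-mono {c = false} {k = 0} ¬vx (λ t → contradiction t ¬vx)) z≤n
      ... | yes vx with up-or-down vx
      ... | inj₁ above = ≤-trans
              (when-mono (λ _ → above) (#-ball≤ G a (proj₁ simple) deg≤ uM m ∘ adj-sym G simple))
              (m≤m+n _ _)
      ... | inj₂ below = ≤-trans (when-mono (λ _ → below) (λ _ → #-subtree≤ m below)) (m≤n+m _ _)

  -- Moving one token through the tree.

  Balanced-resp : ∀ {M M′ out out′ c} → (c ∈ M′ → c ∈ M) → (c ∈ M → c ∈ M′)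
                → inflow out′ c ≤ inflow out c → out′ c ≡ out c
                → Balanced M out c → Balanced M′ out′ c
  Balanced-resp to from in≤ eq (unmarked , marked) rewrite eq =
    (λ c∉ → let i , o = unmarked (c∉ ∘ from) in ≤-trans in≤ i , o) ,
    (λ c∈ → let o , i = marked (to c∈) in o , ≤-trans in≤ i)

  Balanced-∷ : ∀ {M out b c} → c ≢ b → Balanced M out c → Balanced (b ∷ M) out c
  Balanced-∷ c≢b = Balanced-resp (λ { (here c≡b) → contradiction c≡b c≢b ; (there c∈) → c∈ }) there ≤-refl refl

  Balanced-mark : ∀ {M out u} → (∀ c → c ≢ u → Balanced M out c)
                → 1 ≤ out u → inflow out u ≤ suc (out u) → ∀ c → Balanced (u ∷ M) out c
  Balanced-mark {u = u} bal o i c with c ≟ u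
  ... | no c≢u   = Balanced-∷ c≢u (bal c c≢u)
  ... | yes refl = (λ u∉ → contradiction (here refl) u∉) , λ _ → o , i

  -- The state of a vertex holding a token that has not left it yet.
  Loaded : List (Fin n) → (Fin n → ℕ) → Fin n → Set
  Loaded M out c = (c ∉ M → inflow out c ≤ suc (out c) × out c ≤ 1) × (c ∈ M → inflow out c ≤ 2 + out c)

  raise : Fin n → (Fin n → ℕ) → Fin n → ℕ
  raise x out z = out z + (1 when ⌊ x ≟ z ⌋)

  raise-≢ : ∀ {x c} out → c ≢ x → raise x out c ≡ out c
  raise-≢ {x} {c} out c≢x with x ≟ c
  ... | yes refl = contradiction refl c≢x
  ... | no _     = +-identityʳ (out c)

  raise-≡ : ∀ x out → raise x out x ≡ suc (out x)
  raise-≡ x out with x ≟ x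
  ... | yes _  = +-comm (out x) 1
  ... | no x≢x = contradiction refl x≢x

  inflow-raise : ∀ x out c → inflow (raise x out) c ≤ suc (inflow out c)
  inflow-raise x out c = ∑-bump (≟-subsingleton {c = x}) pointwise (allFin⁺ n)
    where
    pointwise : ∀ z → raise x out z when down c z ≤ (out z when down c z) + (1 when ⌊ x ≟ z ⌋)
    pointwise z with down c z
    ... | true  = ≤-refl
    ... | false = z≤n

  inflow-raise-≢ : ∀ {x c} out → ¬ T (down c x) → inflow (raise x out) c ≤ inflow out c
  inflow-raise-≢ {x} {c} out ¬cx = ∑-mono (λ z → when-mono {b = down c z} (λ t → t)
    (λ t → ≤-reflexive (raise-≢ out (λ { refl → ¬cx t })))) V

  -- The token has left through the root; the strict growth at `x` records that it passed `x`.
  Raised : List (Fin n) → (Fin n → ℕ) → Fin n → Set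
  Raised M out x = ∃ λ out′ → (∀ c → Balanced M out′ c) × (∀ c → out c ≤ out′ c) × out x < out′ x

  -- Here `u` is the vertex that Alice marks to restore the balance.
  Stopped : List (Fin n) → Set
  Stopped M = ∃ λ u → u ∉ M × ∃ λ out → ∀ c → Balanced (u ∷ M) out c

  -- Each move to a parent raises the rank and so pays for one unit of `k`. A token leaving `x`
  -- changes the inflow of the parent only, which becomes the one vertex not known to be balanced.
  climb : ∀ k x out {M} → height < k + rank x → (∀ c → c ≢ x → Balanced M out c) → Loaded M out x
        → Raised M out x ⊎ Stopped M
  climb zero    x out h bal ld = contradiction (rank≤height x) (<⇒≱ h)
  climb (suc k) x out {M} h bal (unmarked , marked) = enter
    where
    out⁺ = raise x out

    grows : ∀ c → out c ≤ out⁺ c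
    grows c = m≤m+n (out c) _

    inflow-x : inflow out⁺ x ≤ inflow out x
    inflow-x = inflow-raise-≢ out (λ t → adj-irrefl G simple (proj₁ (down⁻ {x} t)))

    ascend : Balanced M out⁺ x
           → Raised M out x ⊎ Stopped M
    ascend bal-x = upward
      where
      others : ∀ c → ¬ T (down c x) → Balanced M out⁺ c
      others c ¬cx with c ≟ x
      ... | yes refl = bal-x
      ... | no c≢x   = Balanced-resp (λ c∈ → c∈) (λ c∈ → c∈) (inflow-raise-≢ out ¬cx) (raise-≢ out c≢x) (bal c c≢x)

      upward : Raised M out x ⊎ Stopped M
      upward with Fin.any? (λ p → T? (up x p))
      -- At the root, `x` is nobody's child, so every vertex is balanced.
      ... | no none = inj₁ (out⁺ , (λ c → others c (λ cx → none (c , down⇒up cx))) , grows , ≤-reflexive (sym (raise-≡ x out)))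
      ... | yes (p , xp) with up⁻ {x} xp
      ... | adj , x<p
        with climb k p out⁺
               (≤-trans h (≤-trans (≤-reflexive (sym (+-suc k _))) (+-monoʳ-≤ k x<p)))
               (λ c c≢p → others c (λ cx → c≢p (up-unique (down⇒up cx) xp)))
               loaded
        where
        p≢x : p ≢ x
        p≢x refl = adj-irrefl G simple adj
        loaded : Loaded M out⁺ p
        loaded rewrite raise-≢ out p≢x =
          (λ p∉ → let i , o = proj₁ (bal p p≢x) p∉ in ≤-trans (inflow-raise x out p) (s≤s i) , o) ,
          (λ p∈ → ≤-trans (inflow-raise x out p) (s≤s (proj₂ (proj₂ (bal p p≢x) p∈))))
      ... | inj₂ stopped = inj₂ stopped
      ... | inj₁ (out′ , bal′ , ge , _) =
        inj₁ (out′ , bal′ , (λ c → ≤-trans (grows c) (ge c)) , ≤-trans (≤-reflexive (sym (raise-≡ x out))) (ge x))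

    enter : Raised M out x ⊎ Stopped M
    enter with x ∈? M
    ... | yes x∈ = ascend (subst (λ o → BalancedAt M x o (inflow out⁺ x)) (sym (raise-≡ x out))
                     (contradiction x∈ , λ _ → s≤s z≤n , ≤-trans inflow-x (marked x∈)))
    ... | no x∉ with 1 ≤? out x
    -- A token has left `x` before, so `x` may be marked, and the new token fits into `suc (out x)`.
    ... | yes 1≤ = inj₂ (x , x∉ , out , Balanced-mark bal 1≤ (proj₁ (unmarked x∉)))
    ... | no 1≰  = ascend (subst (λ o → BalancedAt M x o (inflow out⁺ x)) (sym (raise-≡ x out))
                     ((λ _ → ≤-trans inflow-x (proj₁ (unmarked x∉)) , ≰⇒> 1≰) , λ x∈ → contradiction x∈ x∉))

  -- If the token released at `v` leaves the root, then `v` has sent out a token, as `Balanced`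
  -- demands of a marked vertex.
  free-move : ∀ {M out v} → (∀ c → Balanced M out c) → v ∉ M → Stopped M
  free-move {M} {out} {v} bal v∉
    with climb (suc height) v out (s≤s (m≤m+n height _)) (λ c _ → bal c)
           ((λ _ → let i , o = proj₁ (bal v) v∉ in m≤n⇒m≤1+n i , o) , λ v∈ → contradiction v∈ v∉)
  ... | inj₂ stopped = stopped
  ... | inj₁ (out′ , bal′ , _ , lt) =
    v , v∉ , out′ , Balanced-mark (λ c _ → bal′ c) (≤-trans (s≤s z≤n) lt) (m≤n⇒m≤1+n (proj₁ (proj₁ (bal′ v) v∉)))

  reply : ∀ {M out b} → (∀ c → Balanced M out c) → b ∉ M → (∀ v → v ∈ b ∷ M) ⊎ Stopped (b ∷ M)
  reply {M} {out} {b} bal b∉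
    with climb (suc height) b out {b ∷ M} (s≤s (m≤m+n height _)) (λ c c≢b → Balanced-∷ c≢b (bal c))
           -- Until Bob marked it, `b` had inflow at most `out b`, two less than `Loaded` allows.
           (contradiction (here refl) , λ _ → m≤n⇒m≤1+n (m≤n⇒m≤1+n (proj₁ (proj₁ (bal b) b∉))))
  ... | inj₂ stopped = inj₂ stopped
  ... | inj₁ (out′ , bal′ , _) with Fin.any? (λ v → ¬? (v ∈? (b ∷ M)))
  ... | yes (v , v∉) = inj₂ (free-move bal′ v∉)
  ... | no none      = inj₁ (λ v → decidable-stable (v ∈? (b ∷ M)) (λ v∉ → none (v , v∉)))

  -- Alice's strategy and the score.

  module _ {a} (deg≤ : ∀ v → deg G v ≤ suc a) (m : ℕ) where

    score : ℕ
    score = geometric a m + 2 ^ m + 1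

    -- One `suc` is for the vertex Bob marks before Alice's reply, the other for the strict
    -- inequality in the game.
    threshold : suc (suc (geometric a m + geometric 2 m)) ≤ score
    threshold = ≤-reflexive (trans (shift (geometric a m) (geometric 2 m))
                                   (cong (λ t → geometric a m + t + 1) (geometric-2 m)))
      where
      shift : ∀ g e → suc (suc (g + e)) ≡ g + suc e + 1
      shift = solve-∀

    mutual
      -- The position after each move of Alice is balanced. Fuel `k` drops by one per round while
      -- `M` gains two vertices.
      bob-turn : ∀ k {M out} → n ≤ k + length M → Unique M → (∀ c → Balanced M out c)
               → BobTurn (power G m) score M
      bob-turn k n≤ uM bal = respond λ b b∉ →
        <-≤-trans (s≤s (m≤n⇒m≤1+n (backDeg≤ uM bal deg≤ m b∉))) threshold , alice-turn k n≤ uM bal b∉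

      alice-turn : ∀ k {M out b} → n ≤ k + length M → Unique M → (∀ c → Balanced M out c) → b ∉ M
                 → AliceWins (power G m) score (b ∷ M)
      alice-turn zero    {M} n≤ uM bal b∉ = contradiction (Unique⇒length≤ (¬Any⇒All¬ M b∉ ∷ uM)) (<⇒≱ (s≤s n≤))
      alice-turn (suc k) {M} {b = b} n≤ uM bal b∉ with reply bal b∉
      ... | inj₁ all = finished all
      ... | inj₂ (u , u∉ , out′ , bal′) = move u u∉
        -- The bound applies to `M`, the position before Bob's move; `b` adds at most one.
        (<-≤-trans (s≤s (≤-trans (#-cons (power G m u) b M) (s≤s (backDeg≤ uM bal deg≤ m (u∉ ∘ there))))) threshold)
        (bob-turn k
          (≤-trans n≤ (≤-trans (n≤1+n _) (≤-reflexive (sym (trans (+-suc k _) (cong suc (+-suc k _)))))))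
          (¬Any⇒All¬ (b ∷ M) u∉ ∷ ¬Any⇒All¬ M b∉ ∷ uM) bal′)

    -- With no token released the empty position is balanced, so Alice can open with a free move.
    alice-first : Fin n → ColGameLe (power G m) score
    alice-first v with free-move {[]} {λ _ → 0} {v} balanced (λ ())
      where
      balanced : ∀ c → Balanced [] (λ _ → 0) c
      balanced c = (λ _ → ≤-trans (∑-mono (λ z → when-mono {b = down c z} (λ t → t) (λ _ → z≤n)) V)
                            (≤-trans (≤-reflexive (∑-const (down c) 0 V)) (≤-reflexive (*-zeroʳ (# (down c) V)))) , z≤n)
                 , λ ()
    ... | u , u∉ , out , bal = move u u∉ (<-≤-trans (s≤s z≤n) threshold) (bob-turn n (m≤m+n n _) ([] ∷ []) bal)

theorem2 : ∀ {n : ℕ} (F : Adj n) (Δ m : ℕ) → IsSimpleGraph F → IsForest F → MaxDegree F Δ → 3 ≤ Δ → .{{_ : NonZero (Δ ∸ 2)}}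
    → ColGameLe (power F m) (((Δ ∸ 1) ^ m ∸ 1) / (Δ ∸ 2) + 2 ^ m + 1)
theorem2 {n} F (suc (suc (suc a))) m simple forest (deg≤ , v , _) (s≤s (s≤s (s≤s _))) =
  -- `deg≤` is used with `2 + a`, the maximum degree minus one; the vertex `v` attaining the maximum
  -- is where Alice releases her first token.
  subst (λ g → ColGameLe (power F m) (g + 2 ^ m + 1)) (geometric-closed a m)
    (Rooted.alice-first F simple (root F simple forest _ (allFin n) ≤-refl) deg≤ m v)
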